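{- For every $M>0$ there exists an instance of \textsf{Min-Max-Delay} (a directed graph with non-negative integer edge capacities and delays, a source $s$, a sink $t\neq s$, and a positive integer rate requirement $R$) for which both \textsf{Min-Max-Delay} and \textsf{Int-Min-Max-Delay} are feasible and the integrality gap $\mathcal{D}(f_{\mathsf{IMM}})/\mathcal{D}(f_{\mathsf{MM}})$ is at least $M$. That is, the integrality gap can be arbitrarily large.
   Context: Let $P$ be the set of directed $s$-$t$ paths, $d^p=\sum_{e\in p}d_e$. A flow is $f=\{f^p\ge 0: p\in P\}$; it is feasible if $\sum_{p\in P}f^p=R$ and $\sum_{p\in P: e\in p}f^p\le c_e$ for all edges $e$. Its maximum delay is $\mathcal{D}(f)=\max_{p\in P: f^p>0}d^p$. \textsf{Min-Max-Delay} minimizes $\mathcal{D}(f)$ over feasible flows with real rates; \textsf{Int-Min-Max-Delay} minimizes $\mathcal{D}(f)$ over feasible flows with all $f^p$ non-negative integers. $f_{\mathsf{MM}}$ and $f_{\mathsf{IMM}}$ denote optimal solutions of these two problems respectively, and the integrality gap is $\mathcal{D}(f_{\mathsf{IMM}})/\mathcal{D}(f_{\mathsf{MM}})$. -}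

module Defs where

open import Data.Nat as ℕ using (ℕ; zero; suc)
open import Data.Fin using (Fin)
open import Data.Fin.Properties using () renaming (_≟_ to _≟F_)
open import Data.Integer using (+_)
open import Data.Rational as ℚ using (ℚ; 0ℚ; _/_)
open import Data.Rational.Properties using (_<?_)
open import Data.List using (List; []; _∷_; map)
open import Data.Nat.ListAction using (sum)
open import Data.List.Relation.Unary.All using (All)
open import Data.List.Relation.Unary.Unique.Propositional using (Unique)
open import Data.Product using (_×_; _,_; ∃; proj₁; proj₂)
open import Relation.Binary.PropositionalEquality using (_≡_)
open import Relation.Nullary using (¬_; yes; no)

record Instance : Set where
  field
    n m   : ℕ
    tail  : Fin m → Fin n
    head  : Fin m → Fin n
    cap   : Fin m → ℕ
    delay : Fin m → ℕ
    s t   : Fin n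
    s≢t   : ¬ (s ≡ t)
    R     : ℕ
    R>0   : 0 ℕ.< R

module _ (I : Instance) where
  open Instance I
  open import Data.List.Membership.DecPropositional (_≟F_ {m}) using (_∈?_)

  data Walk : Fin n → Fin n → List (Fin m) → Set where
    []  : ∀ {u} → Walk u u []
    _∷_ : ∀ {u v e es} → tail e ≡ u → Walk (head e) v es → Walk u v (e ∷ es)

  vertices : Fin n → List (Fin m) → List (Fin n)
  vertices u []       = u ∷ []
  vertices u (e ∷ es) = u ∷ vertices (head e) es

  IsSTPath : List (Fin m) → Set
  IsSTPath p = Walk s t p × Unique (vertices s p)

  pathDelay : List (Fin m) → ℕ
  pathDelay p = sum (map delay p)

  -- A flow: a finite list of (path, rate) pairs (f^p = sum of rates listed for p;
  -- paths not listed carry rate 0).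
  Flow : Set
  Flow = List (List (Fin m) × ℚ)

  total : Flow → ℚ
  total []              = 0ℚ
  total ((_ , r) ∷ f)   = r ℚ.+ total f

  load : Fin m → Flow → ℚ
  load e []             = 0ℚ
  load e ((p , r) ∷ f) with e ∈? p
  ... | yes _ = r ℚ.+ load e f
  ... | no  _ = load e f

  Feasible : Flow → Set
  Feasible f =
      All (λ pr → IsSTPath (proj₁ pr) × 0ℚ ℚ.≤ proj₂ pr) f
    × total f ≡ (+ R) / 1
    × (∀ e → load e f ℚ.≤ (+ cap e) / 1)

  IntegralFlow : Flow → Set
  IntegralFlow f = All (λ pr → ∃ λ (k : ℕ) → proj₂ pr ≡ (+ k) / 1) f

  -- 𝒟(f) = max { d^p : f^p > 0 } (0 if no path carries positive flow).
  maxDelay : Flow → ℕ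
  maxDelay []            = 0
  maxDelay ((p , r) ∷ f) with 0ℚ <? r
  ... | yes _ = pathDelay p ℕ.⊔ maxDelay f
  ... | no  _ = maxDelay f

{-# OPTIONS --safe #-}

-- Between consecutive "spine" vertices the network has two parallel gates, each
-- of capacity 1, and each gate has its own unit-capacity source (the tap) and its
-- own unit-capacity sink (the drain), also joined by a bypass.  The rate
-- requirement saturates every edge out of s.  In an integral flow the path on the
-- spine crosses some gate, so the unit coming from the tap of that gate must
-- bypass it and fills its drain; the spine path therefore has to return to the
-- spine, and pays the delay of every stage.  With rates 1/2 each gate is shared:
-- the half unit arriving on the spine leaves by the drain and the half unit of the
-- tap replaces it on the spine, so every path pays only once.
module Submission where

open import Defs
open import Data.Nat using (ℕ; _*_; _≤_; _<_)
open import Data.Product using (Σ; _×_)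

open import Data.Nat using (zero; suc; _+_; z≤n; s≤s)
import Data.Nat.Properties as ℕₚ
open import Data.Nat.ListAction using (sum)
open import Data.Nat.Tactic.RingSolver using (solve-∀)
import Data.Nat.Coprimality as Coprime
open import Data.Integer using (+_)
import Data.Integer as ℤ
import Data.Integer.Properties as ℤₚ
open import Data.Rational as ℚ using (ℚ; mkℚ; 0ℚ; 1ℚ; ½; _/_)
import Data.Rational.Properties as ℚₚ
open import Algebra.Properties.Monoid.Mult ℚₚ.+-0-monoid using (×-assocˡ) renaming (_×_ to _·_)
open import Data.Fin using (Fin; zero; suc; toℕ; fromℕ; inject₁)
open import Data.Fin.Patterns
import Data.Fin.Properties as Finₚ
open import Data.Fin.Induction using (>-weakInduction)
open import Data.Fin.Relation.Unary.Top using (View; ‵fromℕ; ‵inj₁; view)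
open import Data.List using (List; []; _∷_; _++_; map; length; filter; allFin; replicate)
import Data.List.Properties as Listₚ
open import Data.List.Relation.Unary.All as All using (All; []; _∷_)
import Data.List.Relation.Unary.All.Properties as Allₚ
open import Data.List.Relation.Unary.Any using (Any; here; there; any?)
import Data.List.Relation.Unary.Any.Properties as Anyₚ
open import Data.List.Relation.Unary.AllPairs using ([]; _∷_)
open import Data.List.Relation.Unary.Unique.Propositional using (Unique)
import Data.List.Relation.Unary.Unique.Propositional.Properties as Uniqueₚ
open import Data.List.Membership.Propositional using (_∈_; find; lose)
open import Data.List.Membership.Propositional.Properties using (∈-map⁺; ∈-map⁻; ∈-filter⁺; ∈-filter⁻; ∈-allFin; ∈-∃++)
import Data.List.Membership.DecPropositional as DecMembership
open import Data.List.Relation.Binary.Subset.Propositional using (_⊆_)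
open import Data.Product using (∃; _,_; proj₁; proj₂)
open import Data.Product.Function.NonDependent.Propositional using (_×-↔_)
open import Data.Sum using (_⊎_; inj₁; inj₂; [_,_]′)
open import Data.Sum.Function.Propositional using (_⊎-↔_)
open import Function using (_∘_; id)
open import Function.Bundles using (_↔_; Inverse; mk↔ₛ′)
open import Function.Construct.Composition using (_↔-∘_)
open import Function.Construct.Identity using (↔-id)
open import Relation.Binary.PropositionalEquality
open import Relation.Nullary using (¬_; yes; no; contradiction; ¬?)
open import Relation.Unary using (Decidable)

-- Natural numbers as rationals

-- For a variable `k` the fraction `+ k / 1` is stuck on a gcd; rewriting it to `mkℚ` lets addition
-- and comparison reduce.
/1≡mkℚ : ∀ k → + k / 1 ≡ mkℚ (+ k) 0 (Coprime.sym (Coprime.1-coprimeTo k))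
/1≡mkℚ k = ℚₚ.normalize-coprime (Coprime.sym (Coprime.1-coprimeTo k))

/1-homo-+ : ∀ i j → + (i + j) / 1 ≡ (+ i / 1) ℚ.+ (+ j / 1)
/1-homo-+ i j rewrite /1≡mkℚ i | /1≡mkℚ j =
  cong (_/ 1) (cong₂ ℤ._+_ (sym (ℤₚ.*-identityʳ (+ i))) (sym (ℤₚ.*-identityʳ (+ j))))

/1-cancel-≤ : ∀ {i j} → (+ i / 1) ℚ.≤ (+ j / 1) → i ≤ j
/1-cancel-≤ {i} {j} i≤j rewrite /1≡mkℚ i | /1≡mkℚ j =
  ℤₚ.drop‿+≤+ (subst₂ ℤ._≤_ (ℤₚ.*-identityʳ (+ i)) (ℤₚ.*-identityʳ (+ j)) (ℚₚ.drop-*≤* i≤j))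

/1-injective : ∀ {i j} → + i / 1 ≡ + j / 1 → i ≡ j
/1-injective eq = ℕₚ.≤-antisym (/1-cancel-≤ (ℚₚ.≤-reflexive eq)) (/1-cancel-≤ (ℚₚ.≤-reflexive (sym eq)))

·1≡/1 : ∀ k → k · 1ℚ ≡ + k / 1
·1≡/1 zero    = refl
·1≡/1 (suc k) = trans (cong (1ℚ ℚ.+_) (·1≡/1 k)) (sym (/1-homo-+ 1 k))

0≤k·r : ∀ k {r} → 0ℚ ℚ.≤ r → 0ℚ ℚ.≤ k · r
0≤k·r zero    0≤r = ℚₚ.≤-refl
0≤k·r (suc k) 0≤r = ℚₚ.+-mono-≤ 0≤r (0≤k·r k 0≤r)

·-monoˡ-≤ : ∀ {i j r} → 0ℚ ℚ.≤ r → i ≤ j → i · r ℚ.≤ j · r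
·-monoˡ-≤ {j = j} 0≤r z≤n       = 0≤k·r j 0≤r
·-monoˡ-≤ {r = r} 0≤r (s≤s i≤j) = ℚₚ.+-monoʳ-≤ r (·-monoˡ-≤ 0≤r i≤j)

positive-/1 : ∀ k → 0ℚ ℚ.< + suc k / 1
positive-/1 k = ℚₚ.≰⇒> λ 1+k≤0 → contradiction (/1-cancel-≤ {suc k} {0} 1+k≤0) λ ()

-- Enumerations and counting in lists

module _ {A : Set} where

  -- Pigeonhole: cutting one occurrence of the head out of `ys` loses no element of the tail,
  -- because the tail does not contain the head.
  Unique-⊆⇒length-≤ : {xs ys : List A} → Unique xs → xs ⊆ ys → length xs ≤ length ys
  Unique-⊆⇒length-≤ {[]}     _            _     = z≤n
  Unique-⊆⇒length-≤ {x ∷ xs} (x∉xs ∷ uxs) x∷xs⊆ys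
    with us , vs , refl ← ∈-∃++ (x∷xs⊆ys (here refl)) = begin
      suc (length xs)         ≤⟨ s≤s (Unique-⊆⇒length-≤ uxs xs⊆) ⟩
      suc (length (us ++ vs)) ≡⟨ Listₚ.length-++-sucʳ us x vs ⟨
      length (us ++ x ∷ vs)   ∎
    where
    open ℕₚ.≤-Reasoning
    xs⊆ : xs ⊆ us ++ vs
    xs⊆ y∈xs with Anyₚ.++⁻ us (x∷xs⊆ys (there y∈xs))
    ... | inj₁ y∈us         = Anyₚ.++⁺ˡ y∈us
    ... | inj₂ (here refl)  = contradiction refl (All.lookup x∉xs y∈xs)
    ... | inj₂ (there y∈vs) = Anyₚ.++⁺ʳ us y∈vs

  module _ {n : ℕ} (A↔ : Fin n ↔ A) where
    open Inverse A↔

    to-injective : ∀ {i j} → to i ≡ to j → i ≡ j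
    to-injective eq = trans (sym (strictlyInverseʳ _)) (trans (cong from eq) (strictlyInverseʳ _))

    from-injective : ∀ {x y} → from x ≡ from y → x ≡ y
    from-injective eq = trans (sym (strictlyInverseˡ _)) (trans (cong to eq) (strictlyInverseˡ _))

    enumerate : List A
    enumerate = map to (allFin n)

    length-enumerate : length enumerate ≡ n
    length-enumerate = trans (Listₚ.length-map to (allFin n)) (Listₚ.length-tabulate id)

    enumerate-unique : Unique enumerate
    enumerate-unique = Uniqueₚ.map⁺ to-injective (Uniqueₚ.allFin⁺ n)

    ∈-enumerate : ∀ x → x ∈ enumerate
    ∈-enumerate x = subst (_∈ enumerate) (strictlyInverseˡ x) (∈-map⁺ to (∈-allFin (from x)))

-- Edge usage in lists of paths, and saturation of cuts

module _ {m : ℕ} where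
  open DecMembership (Finₚ._≟_ {m}) using (_∈?_)

  uses : Fin m → List (List (Fin m)) → ℕ
  uses e ps = length (filter (e ∈?_) ps)

  -- Indices are counted rather than paths, so `path` may take the same value twice.
  uses-map-≤ : ∀ {I : Set} {e} (path : I → List (Fin m)) {is js} → Unique is →
               (∀ i → e ∈ path i → i ∈ js) → uses e (map path is) ≤ length js
  uses-map-≤ {e = e} path {is} {js} uis carriers = begin
    uses e (map path is)                     ≡⟨ uses-map is ⟩
    length (filter (λ i → e ∈? path i) is)   ≤⟨ Unique-⊆⇒length-≤ (Uniqueₚ.filter⁺ (λ i → e ∈? path i) uis) carried ⟩
    length js                                ∎
    where
    open ℕₚ.≤-Reasoning
    carried : filter (λ i → e ∈? path i) is ⊆ js
    carried {i} i∈ = carriers i (proj₂ (∈-filter⁻ (λ i → e ∈? path i) {xs = is} i∈))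
    uses-map : ∀ is → uses e (map path is) ≡ length (filter (λ i → e ∈? path i) is)
    uses-map []       = refl
    uses-map (i ∷ is) with e ∈? path i
    ... | yes _ = cong suc (uses-map is)
    ... | no  _ = uses-map is

  shared⇒2≤uses : ∀ {e p q ps} → p ∈ ps → q ∈ ps → ¬ p ≡ q → e ∈ p → e ∈ q → 2 ≤ uses e ps
  shared⇒2≤uses {e} {p} {q} {ps} p∈ps q∈ps p≢q e∈p e∈q =
    Unique-⊆⇒length-≤ {xs = p ∷ q ∷ []} ((p≢q ∷ []) ∷ [] ∷ []) λ where
      (here refl)         → ∈-filter⁺ (e ∈?_) p∈ps e∈p
      (there (here refl)) → ∈-filter⁺ (e ∈?_) q∈ps e∈q

  uses-filter-≤ : ∀ {P : List (Fin m) → Set} (P? : Decidable P) e ps → uses e (filter P? ps) ≤ uses e ps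
  uses-filter-≤ P? e []       = z≤n
  uses-filter-≤ P? e (p ∷ ps) with ih ← uses-filter-≤ P? e ps | P? p
  ... | yes _ with e ∈? p
  ...   | yes _ = s≤s ih
  ...   | no  _ = ih
  uses-filter-≤ P? e (p ∷ ps) | no _ with e ∈? p
  ...   | yes _ = ℕₚ.m≤n⇒m≤1+n ih
  ...   | no  _ = ih

  length≡uses+rest : ∀ e ps → length ps ≡ uses e ps + length (filter (¬? ∘ (e ∈?_)) ps)
  length≡uses+rest e []       = refl
  length≡uses+rest e (p ∷ ps) with e ∈? p
  ... | yes _ = cong suc (length≡uses+rest e ps)
  ... | no  _ = trans (cong suc (length≡uses+rest e ps)) (sym (ℕₚ.+-suc _ _))

  -- Induction on `S`: at most one path uses the first edge, and the paths that avoid it are still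
  -- hit by the remaining edges.
  cut-length-≤ : ∀ S ps → All (λ p → Any (_∈ p) S) ps → (∀ {e} → e ∈ S → uses e ps ≤ 1) →
                 length ps ≤ length S
  cut-length-≤ []      []      _        _   = z≤n
  cut-length-≤ []      (_ ∷ _) (() ∷ _) _
  cut-length-≤ (e ∷ S) ps      hit      cap = begin
    length ps                ≡⟨ length≡uses+rest e ps ⟩
    uses e ps + length rest  ≤⟨ ℕₚ.+-mono-≤ (cap (here refl)) (cut-length-≤ S rest rest-hit rest-cap) ⟩
    suc (length S)           ∎
    where
    open ℕₚ.≤-Reasoning
    rest = filter (¬? ∘ (e ∈?_)) ps
    rest-hit : All (λ p → Any (_∈ p) S) rest
    rest-hit = All.tabulate λ p∈rest → let p∈ps , e∉p = ∈-filter⁻ (¬? ∘ (e ∈?_)) p∈rest in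
      case-hit e∉p (All.lookup hit p∈ps)
      where
      case-hit : ∀ {p} → ¬ e ∈ p → Any (_∈ p) (e ∷ S) → Any (_∈ p) S
      case-hit e∉p (here e∈p) = contradiction e∈p e∉p
      case-hit _   (there h)  = h
    rest-cap : ∀ {e′} → e′ ∈ S → uses e′ rest ≤ 1
    rest-cap e′∈S = ℕₚ.≤-trans (uses-filter-≤ (¬? ∘ (e ∈?_)) _ ps) (cap (there e′∈S))

  cut-saturated : ∀ S ps → All (λ p → Any (_∈ p) S) ps → (∀ {e} → e ∈ S → uses e ps ≤ 1) →
                  length S ≤ length ps → ∀ {e} → e ∈ S → Any (e ∈_) ps
  cut-saturated S ps hit cap S≤ps {e} e∈S with any? (e ∈?_) ps
  ... | yes used   = used
  ... | no  unused with us , vs , refl ← ∈-∃++ e∈S =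
    contradiction (ℕₚ.≤-trans (ℕₚ.≤-reflexive (sym (Listₚ.length-++-sucʳ us e vs)))
                    (ℕₚ.≤-trans S≤ps (cut-length-≤ (us ++ vs) ps hit′ (cap ∘ widen))))
                  ℕₚ.1+n≰n
    where
    widen : us ++ vs ⊆ us ++ e ∷ vs
    widen = [ Anyₚ.++⁺ˡ , Anyₚ.++⁺ʳ us ∘ there ]′ ∘ Anyₚ.++⁻ us
    drop-e : ∀ {p} → ¬ e ∈ p → Any (_∈ p) (us ++ e ∷ vs) → Any (_∈ p) (us ++ vs)
    drop-e e∉p h with Anyₚ.++⁻ us h
    ... | inj₁ h∈us         = Anyₚ.++⁺ˡ h∈us
    ... | inj₂ (here e∈p)   = contradiction e∈p e∉p
    ... | inj₂ (there h∈vs) = Anyₚ.++⁺ʳ us h∈vs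
    hit′ : All (λ p → Any (_∈ p) (us ++ vs)) ps
    hit′ = All.zipWith (λ (e∉p , h) → drop-e e∉p h) (Allₚ.¬Any⇒All¬ ps unused , hit)

-- Uniform and integral flows

module _ (I : Instance) where
  open Instance I
  open DecMembership (Finₚ._≟_ {m}) using (_∈?_)

  uniform : ℚ → List (List (Fin m)) → Flow I
  uniform r = map (_, r)

  total-uniform : ∀ r ps → total I (uniform r ps) ≡ length ps · r
  total-uniform r []       = refl
  total-uniform r (p ∷ ps) = cong (r ℚ.+_) (total-uniform r ps)

  load-uniform : ∀ e r ps → load I e (uniform r ps) ≡ uses e ps · r
  load-uniform e r []       = refl
  load-uniform e r (p ∷ ps) with e ∈? p
  ... | yes _ = cong (r ℚ.+_) (load-uniform e r ps)
  ... | no  _ = load-uniform e r ps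

  -- Here `r` is `1/q`, so feasibility turns into counting: `R * q` paths in all, at most
  -- `cap e * q` of them through `e`.
  uniform-feasible : ∀ {r} q ps → 0ℚ ℚ.≤ r → q · r ≡ 1ℚ → All (IsSTPath I) ps →
                     length ps ≡ R * q → (∀ e → uses e ps ≤ cap e * q) → Feasible I (uniform r ps)
  uniform-feasible {r} q ps 0≤r q·r≡1 paths length≡ uses≤ =
      Allₚ.map⁺ (All.map (_, 0≤r) paths)
    , (begin
        total I (uniform r ps) ≡⟨ total-uniform r ps ⟩
        length ps · r          ≡⟨ cong (_· r) length≡ ⟩
        (R * q) · r            ≡⟨ multiple R ⟩
        + R / 1                ∎)
    , λ e → subst₂ ℚ._≤_ (sym (load-uniform e r ps)) (multiple (cap e)) (·-monoˡ-≤ 0≤r (uses≤ e))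
    where
    open ≡-Reasoning
    multiple : ∀ k → (k * q) · r ≡ + k / 1
    multiple k = begin
      (k * q) · r ≡⟨ ×-assocˡ r k q ⟨
      k · (q · r) ≡⟨ cong (k ·_) q·r≡1 ⟩
      k · 1ℚ      ≡⟨ ·1≡/1 k ⟩
      + k / 1     ∎

  maxDelay-uniform-≤ : ∀ {D} r {ps} → All (λ p → pathDelay I p ≤ D) ps → maxDelay I (uniform r ps) ≤ D
  maxDelay-uniform-≤ r []       = z≤n
  maxDelay-uniform-≤ r (d ∷ ds) with 0ℚ ℚₚ.<? r
  ... | yes _ = ℕₚ.⊔-lub d (maxDelay-uniform-≤ r ds)
  ... | no  _ = maxDelay-uniform-≤ r ds

  maxDelay-tail-≤ : ∀ p r f → maxDelay I f ≤ maxDelay I ((p , r) ∷ f)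
  maxDelay-tail-≤ p r f with 0ℚ ℚₚ.<? r
  ... | yes _ = ℕₚ.m≤n⊔m _ _
  ... | no  _ = ℕₚ.≤-refl

  pathDelay≤maxDelay : ∀ {p r f} → (p , r) ∈ f → 0ℚ ℚ.< r → pathDelay I p ≤ maxDelay I f
  pathDelay≤maxDelay {r = r} (here refl) 0<r with 0ℚ ℚₚ.<? r
  ... | yes _   = ℕₚ.m≤m⊔n _ _
  ... | no  0≮r = contradiction 0<r 0≮r
  pathDelay≤maxDelay {f = (q , r′) ∷ f} (there p∈f) 0<r =
    ℕₚ.≤-trans (pathDelay≤maxDelay p∈f 0<r) (maxDelay-tail-≤ q r′ f)

  uniform-1-integral : ∀ ps → IntegralFlow I (uniform 1ℚ ps)
  uniform-1-integral ps = Allₚ.map⁺ (All.tabulate λ _ → 1 , refl)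

  -- An integral flow unfolded into unit paths with multiplicity: total and loads become counts, to
  -- which the cut lemmas apply.
  record UnitPaths (f : Flow I) : Set where
    field
      paths     : List (List (Fin m))
      isSTPath  : All (IsSTPath I) paths
      total≡    : total I f ≡ + length paths / 1
      load≡     : ∀ e → load I e f ≡ + uses e paths / 1
      delay≤    : All (λ p → pathDelay I p ≤ maxDelay I f) paths

  unitPaths : ∀ f → All (λ pr → IsSTPath I (proj₁ pr)) f → IntegralFlow I f → UnitPaths f
  unitPaths []            []         []                 = record
    { paths = [] ; isSTPath = [] ; total≡ = refl ; load≡ = λ _ → refl ; delay≤ = [] }
  unitPaths ((p , r) ∷ f) (st ∷ sts) ((k , refl) ∷ ints) = record
    { paths    = replicate k p ++ U.paths
    ; isSTPath = Allₚ.++⁺ (Allₚ.replicate⁺ k st) U.isSTPath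
    ; total≡   = begin
        (+ k / 1) ℚ.+ total I f                  ≡⟨ cong₂ (λ i → (+ i / 1) ℚ.+_) (sym (Listₚ.length-replicate k)) U.total≡ ⟩
        (+ length (replicate k p) / 1) ℚ.+ (+ length U.paths / 1)
                                                 ≡⟨ /1-homo-+ (length (replicate k p)) (length U.paths) ⟨
        + (length (replicate k p) + length U.paths) / 1
                                                 ≡⟨ cong (λ i → + i / 1) (Listₚ.length-++ (replicate k p)) ⟨
        + length (replicate k p ++ U.paths) / 1  ∎
    ; load≡    = load≡
    ; delay≤   = Allₚ.++⁺ (copies k) (All.map (λ d → ℕₚ.≤-trans d (maxDelay-tail-≤ p r f)) U.delay≤)
    }
    where
    open ≡-Reasoning
    module U = UnitPaths (unitPaths f sts ints)
    copies : ∀ k → All (λ q → pathDelay I q ≤ maxDelay I ((p , + k / 1) ∷ f)) (replicate k p)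
    -- `maxDelay` ignores a path of rate 0, and such a path has no copies here, so nothing has to be
    -- bounded.
    copies zero    = []
    copies (suc k) = Allₚ.replicate⁺ (suc k)
      (pathDelay≤maxDelay {r = + suc k / 1} {f = (p , + suc k / 1) ∷ f} (here refl) (positive-/1 k))
    uses-replicate-yes : ∀ {e} k → e ∈ p → uses e (replicate k p ++ U.paths) ≡ k + uses e U.paths
    uses-replicate-yes         zero    e∈p = refl
    uses-replicate-yes {e = e} (suc k) e∈p =
      trans (cong length (Listₚ.filter-accept (e ∈?_) e∈p)) (cong suc (uses-replicate-yes k e∈p))
    uses-replicate-no : ∀ {e} k → ¬ e ∈ p → uses e (replicate k p ++ U.paths) ≡ uses e U.paths
    uses-replicate-no         zero    e∉p = refl
    uses-replicate-no {e = e} (suc k) e∉p =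
      trans (cong length (Listₚ.filter-reject (e ∈?_) e∉p)) (uses-replicate-no k e∉p)
    load≡ : ∀ e → load I e ((p , + k / 1) ∷ f) ≡ + uses e (replicate k p ++ U.paths) / 1
    load≡ e with e ∈? p
    ... | yes e∈p = begin
      (+ k / 1) ℚ.+ load I e f                    ≡⟨ cong ((+ k / 1) ℚ.+_) (U.load≡ e) ⟩
      (+ k / 1) ℚ.+ (+ uses e U.paths / 1)        ≡⟨ /1-homo-+ k (uses e U.paths) ⟨
      + (k + uses e U.paths) / 1                  ≡⟨ cong (λ i → + i / 1) (uses-replicate-yes k e∈p) ⟨
      + uses e (replicate k p ++ U.paths) / 1     ∎
    ... | no  e∉p = trans (U.load≡ e) (cong (λ i → + i / 1) (sym (uses-replicate-no k e∉p)))

-- Networks with named vertices and edges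

module Routes {V E : Set} (src tgt : E → V) where

  -- The start index of `_∷_` is the stuck term `src e`. Lemmas on routes from a given vertex
  -- therefore take the start as a variable with an equation, matched once the edge is known.
  data Route (v : V) : V → List E → Set where
    []  : Route v v []
    _∷_ : ∀ {es} e → Route v (tgt e) es → Route v (src e) (e ∷ es)

  infixr 5 _◅◅_
  _◅◅_ : ∀ {u v w es fs} → Route v u es → Route w v fs → Route w u (es ++ fs)
  []      ◅◅ ρ′ = ρ′
  (e ∷ ρ) ◅◅ ρ′ = e ∷ (ρ ◅◅ ρ′)

  visited : V → List E → List V
  visited u []       = u ∷ []
  visited u (e ∷ es) = u ∷ visited (tgt e) es

  -- After its first edge a route is never at `s` again, so an edge leaving `s` can only come first.
  root-edge-first : ∀ {s v es e} → (∀ e → ¬ tgt e ≡ s) → Route v s es → src e ≡ s → e ∈ es →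
                    ∃ λ fs → es ≡ e ∷ fs × Route v (tgt e) fs
  root-edge-first noIn (e₀ ∷ ρ) refl (here refl) = _ , refl , ρ
  root-edge-first {s} {v} {e = e} noIn (e₀ ∷ ρ) e-root (there e∈es) = contradiction e∈es (avoid (noIn e₀) ρ)
    where
    avoid : ∀ {u es} → ¬ u ≡ s → Route v u es → ¬ e ∈ es
    avoid u≢s (_ ∷ ρ)  (here refl)  = u≢s e-root
    avoid u≢s (e₁ ∷ ρ) (there e∈es) = avoid (noIn e₁) ρ e∈es

  module _ (rank : V → ℕ) (rank-< : ∀ e → rank (src e) < rank (tgt e)) where

    visited-rank-≥ : ∀ {k u v es} → k ≤ rank u → Route v u es → All (λ w → k ≤ rank w) (visited u es)
    visited-rank-≥ k≤u []      = k≤u ∷ []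
    visited-rank-≥ k≤u (e ∷ ρ) = k≤u ∷ visited-rank-≥ (ℕₚ.≤-trans k≤u (ℕₚ.<⇒≤ (rank-< e))) ρ

    -- Ranks strictly increase along a route, so no vertex can repeat.
    visited-unique : ∀ {u v es} → Route v u es → Unique (visited u es)
    visited-unique []      = [] ∷ []
    visited-unique (e ∷ ρ) =
      All.map (λ u<w u≡w → ℕₚ.<⇒≢ u<w (cong rank u≡w)) (visited-rank-≥ (rank-< e) ρ) ∷ visited-unique ρ

-- Coding a named network as an `Instance`

module Network
  {V E : Set} {n m : ℕ} (V↔ : Fin n ↔ V) (E↔ : Fin m ↔ E)
  (src tgt : E → V) (capacity delay : E → ℕ) (s t : V) (s≢t : ¬ s ≡ t) (R : ℕ) (R>0 : 0 < R)
  where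

  open Routes src tgt
  open Inverse V↔ using () renaming (from to codeV)
  open Inverse E↔ using (strictlyInverseˡ; strictlyInverseʳ) renaming (to to decode; from to code)

  network : Instance
  network = record
    { n = n ; m = m
    ; tail = codeV ∘ src ∘ decode ; head = codeV ∘ tgt ∘ decode
    ; cap = capacity ∘ decode ; delay = delay ∘ decode
    ; s = codeV s ; t = codeV t ; s≢t = s≢t ∘ from-injective V↔
    ; R = R ; R>0 = R>0
    }

  encode : List E → List (Fin m)
  encode = map code

  code-∈ : ∀ {e p} → e ∈ map decode p → code e ∈ p
  code-∈ e∈ with e′ , e′∈p , refl ← ∈-map⁻ decode e∈ = subst (_∈ _) (sym (strictlyInverseʳ e′)) e′∈p

  decode-∈ : ∀ {e es} → e ∈ encode es → decode e ∈ es
  decode-∈ e∈ with e′ , e′∈es , refl ← ∈-map⁻ code e∈ = subst (_∈ _) (sym (strictlyInverseˡ e′)) e′∈es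

  pathDelay-decode : ∀ p → pathDelay network p ≡ sum (map delay (map decode p))
  pathDelay-decode p = cong sum (Listₚ.map-∘ p)

  pathDelay-encode : ∀ es → pathDelay network (encode es) ≡ sum (map delay es)
  pathDelay-encode []       = refl
  pathDelay-encode (e ∷ es) = cong₂ _+_ (cong delay (strictlyInverseˡ e)) (pathDelay-encode es)

  walk⇒route : ∀ {u v p} → Walk network (codeV u) (codeV v) p → Route v u (map decode p)
  walk⇒route = go refl refl
    where
    -- The endpoints become variables `x` and `y`, since values of `codeV` cannot be unified when
    -- matching on a walk; injectivity then recovers the named vertices.
    go : ∀ {u v x y p} → x ≡ codeV u → y ≡ codeV v → Walk network x y p → Route v u (map decode p)
    go x≡u y≡v [] with refl ← from-injective V↔ (trans (sym x≡u) y≡v) = []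
    go x≡u y≡v (_∷_ {e = e} tail≡ w) with refl ← from-injective V↔ (trans tail≡ x≡u) = decode e ∷ go refl y≡v w

  route⇒walk : ∀ {u v es} → Route v u es → Walk network (codeV u) (codeV v) (encode es)
  route⇒walk []      = []
  route⇒walk (e ∷ ρ) =
    cong (codeV ∘ src) (strictlyInverseˡ e) ∷
    subst (λ e′ → Walk network (codeV (tgt e′)) _ _) (sym (strictlyInverseˡ e)) (route⇒walk ρ)

  vertices-encode : ∀ u es → vertices network (codeV u) (encode es) ≡ map codeV (visited u es)
  vertices-encode u []       = refl
  vertices-encode u (e ∷ es) rewrite strictlyInverseˡ e = cong (codeV u ∷_) (vertices-encode (tgt e) es)

  module _ (rank : V → ℕ) (rank-< : ∀ e → rank (src e) < rank (tgt e)) where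

    route⇒isSTPath : ∀ {es} → Route t s es → IsSTPath network (encode es)
    route⇒isSTPath {es} ρ = route⇒walk ρ ,
      subst Unique (sym (vertices-encode s es))
        (Uniqueₚ.map⁺ (from-injective V↔) (visited-unique rank rank-< ρ))

-- The network with N stages

module Stages (N : ℕ) where

  -- A stage together with one of its two parallel gates.
  Port : Set
  Port = Fin N × Fin 2

  data V : Set where
    s t                          : V
    spine                        : Fin (suc N) → V
    tap gateIn gateOut drain     : Port → V

  data E : Set where
    start finish                                             : E
    source bypass inject enter cross leave divert sink       : Port → E

  src : E → V
  src start           = s
  src finish          = spine (fromℕ N)
  src (source _)      = s
  src (bypass p)      = tap p
  src (inject p)      = tap p
  src (enter (j , _)) = spine (inject₁ j)
  src (cross p)       = gateIn p
  src (leave p)       = gateOut p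
  src (divert p)      = gateOut p
  src (sink p)        = drain p

  tgt : E → V
  tgt start           = spine zero
  tgt finish          = t
  tgt (source p)      = tap p
  tgt (bypass p)      = drain p
  tgt (inject p)      = gateIn p
  tgt (enter p)       = gateIn p
  tgt (cross p)       = gateOut p
  tgt (leave (j , _)) = spine (suc j)
  tgt (divert p)      = drain p
  tgt (sink _)        = t

  -- The number of edges out of `s`: `start` and one `source` for each port.
  R : ℕ
  R = suc (N * 2)

  -- The value `R` is as good as unlimited, being the total rate of a feasible flow.
  capacity : E → ℕ
  capacity start      = 1
  capacity (source _) = 1
  capacity (cross _)  = 1
  capacity (sink _)   = 1
  capacity _          = R

  -- The unit on `leave` is the price of returning to the spine. The unit on `start` makes the
  -- maximum delay of the fractional flow positive.
  delay : E → ℕ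
  delay start     = 1
  delay (leave _) = 1
  delay _         = 0

  abstract
    -- Kept abstract: what follows relies only on the laws of a bijection, and codes never unfold.
    V↔ : Fin (4 * (N * 2) + (suc N + 2)) ↔ V
    V↔ = mk↔ₛ′ f g fg gf ↔-∘ ((((↔-id _ ×-↔ Finₚ.*↔×) ↔-∘ Finₚ.*↔×) ⊎-↔ Finₚ.+↔⊎) ↔-∘ Finₚ.+↔⊎)
      where
      f : (Fin 4 × Port) ⊎ (Fin (suc N) ⊎ Fin 2) → V
      f (inj₁ (0F , p))  = tap p
      f (inj₁ (1F , p))  = gateIn p
      f (inj₁ (2F , p))  = gateOut p
      f (inj₁ (3F , p))  = drain p
      f (inj₂ (inj₁ j))  = spine j
      f (inj₂ (inj₂ 0F)) = s
      f (inj₂ (inj₂ 1F)) = t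
      g : V → (Fin 4 × Port) ⊎ (Fin (suc N) ⊎ Fin 2)
      g s           = inj₂ (inj₂ 0F)
      g t           = inj₂ (inj₂ 1F)
      g (spine j)   = inj₂ (inj₁ j)
      g (tap p)     = inj₁ (0F , p)
      g (gateIn p)  = inj₁ (1F , p)
      g (gateOut p) = inj₁ (2F , p)
      g (drain p)   = inj₁ (3F , p)
      fg : ∀ v → f (g v) ≡ v
      fg s           = refl
      fg t           = refl
      fg (spine j)   = refl
      fg (tap p)     = refl
      fg (gateIn p)  = refl
      fg (gateOut p) = refl
      fg (drain p)   = refl
      gf : ∀ c → g (f c) ≡ c
      gf (inj₁ (0F , p))  = refl
      gf (inj₁ (1F , p))  = refl
      gf (inj₁ (2F , p))  = refl
      gf (inj₁ (3F , p))  = refl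
      gf (inj₂ (inj₁ j))  = refl
      gf (inj₂ (inj₂ 0F)) = refl
      gf (inj₂ (inj₂ 1F)) = refl

  edges : ℕ
  edges = 8 * (N * 2) + 2

  abstract
    E↔ : Fin edges ↔ E
    E↔ = mk↔ₛ′ f g fg gf ↔-∘ ((((↔-id _ ×-↔ Finₚ.*↔×) ↔-∘ Finₚ.*↔×) ⊎-↔ ↔-id _) ↔-∘ Finₚ.+↔⊎)
      where
      f : (Fin 8 × Port) ⊎ Fin 2 → E
      f (inj₁ (0F , p)) = source p
      f (inj₁ (1F , p)) = bypass p
      f (inj₁ (2F , p)) = inject p
      f (inj₁ (3F , p)) = enter p
      f (inj₁ (4F , p)) = cross p
      f (inj₁ (5F , p)) = leave p
      f (inj₁ (6F , p)) = divert p
      f (inj₁ (7F , p)) = sink p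
      f (inj₂ 0F)       = start
      f (inj₂ 1F)       = finish
      g : E → (Fin 8 × Port) ⊎ Fin 2
      g (source p) = inj₁ (0F , p)
      g (bypass p) = inj₁ (1F , p)
      g (inject p) = inj₁ (2F , p)
      g (enter p)  = inj₁ (3F , p)
      g (cross p)  = inj₁ (4F , p)
      g (leave p)  = inj₁ (5F , p)
      g (divert p) = inj₁ (6F , p)
      g (sink p)   = inj₁ (7F , p)
      g start      = inj₂ 0F
      g finish     = inj₂ 1F
      fg : ∀ e → f (g e) ≡ e
      fg (source p) = refl
      fg (bypass p) = refl
      fg (inject p) = refl
      fg (enter p)  = refl
      fg (cross p)  = refl
      fg (leave p)  = refl
      fg (divert p) = refl
      fg (sink p)   = refl
      fg start      = refl
      fg finish     = refl
      gf : ∀ c → g (f c) ≡ c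
      gf (inj₁ (0F , p)) = refl
      gf (inj₁ (1F , p)) = refl
      gf (inj₁ (2F , p)) = refl
      gf (inj₁ (3F , p)) = refl
      gf (inj₁ (4F , p)) = refl
      gf (inj₁ (5F , p)) = refl
      gf (inj₁ (6F , p)) = refl
      gf (inj₁ (7F , p)) = refl
      gf (inj₂ 0F)       = refl
      gf (inj₂ 1F)       = refl

  open Routes src tgt
  open Network V↔ E↔ src tgt capacity delay s t (λ ()) R (s≤s z≤n) public
  open Inverse E↔ using (strictlyInverseˡ) renaming (to to decode; from to code)

  -- Each stage takes three consecutive levels. Taps lie below all gates; drains share the level of
  -- the last spine vertex, above all gates.
  rank : V → ℕ
  rank s                 = 0
  rank (tap _)           = 1
  rank (spine j)         = 1 + toℕ j * 3
  rank (gateIn (j , _))  = 2 + toℕ j * 3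
  rank (gateOut (j , _)) = 3 + toℕ j * 3
  rank (drain _)         = 1 + N * 3
  rank t                 = 2 + N * 3

  rank-< : ∀ e → rank (src e) < rank (tgt e)
  rank-< start           = s≤s z≤n
  rank-< finish          rewrite Finₚ.toℕ-fromℕ N = ℕₚ.≤-refl
  rank-< (source _)      = s≤s z≤n
  rank-< (bypass (j , _)) = s≤s (ℕₚ.≤-trans (s≤s z≤n) (ℕₚ.*-monoˡ-≤ 3 (Finₚ.toℕ<n j)))
  rank-< (inject _)      = s≤s (s≤s z≤n)
  rank-< (enter (j , _)) rewrite Finₚ.toℕ-inject₁ j = ℕₚ.≤-refl
  rank-< (cross _)       = ℕₚ.≤-refl
  rank-< (leave _)       = ℕₚ.≤-refl
  rank-< (divert (j , _)) = s≤s (ℕₚ.*-monoˡ-≤ 3 (Finₚ.toℕ<n j))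
  rank-< (sink _)        = ℕₚ.≤-refl

  isSTPath : ∀ {es} → Route t s es → IsSTPath network (encode es)
  isSTPath = route⇒isSTPath rank rank-<

  -- Feasibility from bounds on the edges of capacity 1

  data Bottleneck : E → Set where
    start  : Bottleneck start
    source : ∀ p → Bottleneck (source p)
    cross  : ∀ p → Bottleneck (cross p)
    sink   : ∀ p → Bottleneck (sink p)

  -- Only the bottlenecks need a bound: no edge is used more often than there are paths.
  module Spread
    {I : Set} {k : ℕ} (I↔ : Fin k ↔ I) (q : ℕ) (length≡ : k ≡ R * q) {r : ℚ} (0≤r : 0ℚ ℚ.≤ r) (q·r≡1 : q · r ≡ 1ℚ)
    (path : I → List E) (route : ∀ i → Route t s (path i))
    (carriers : ∀ {e} → Bottleneck e → ∃ λ js → length js ≡ q × ∀ i → e ∈ path i → i ∈ js)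
    where

    paths : List (List (Fin edges))
    paths = map (encode ∘ path) (enumerate I↔)

    length-paths : length paths ≡ R * q
    length-paths = trans (Listₚ.length-map _ (enumerate I↔)) (trans (length-enumerate I↔) length≡)

    uses-≤ : ∀ e → uses e paths ≤ capacity (decode e) * q
    -- `decode e` is opaque; replacing it by a variable with an equation allows a case split under
    -- which `capacity` reduces.
    uses-≤ e = bound (decode e) refl
      where
      narrow : ∀ {e′} → decode e ≡ e′ → Bottleneck e′ → uses e paths ≤ 1 * q
      narrow refl b with js , length≡q , carried ← carriers b = begin
        uses e paths  ≤⟨ uses-map-≤ (encode ∘ path) (enumerate-unique I↔) (λ i → carried i ∘ decode-∈) ⟩
        length js     ≡⟨ length≡q ⟩
        q             ≡⟨ ℕₚ.*-identityˡ q ⟨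
        1 * q         ∎
        where open ℕₚ.≤-Reasoning
      wide : uses e paths ≤ R * q
      wide = ℕₚ.≤-trans (Listₚ.length-filter _ paths) (ℕₚ.≤-reflexive length-paths)
      bound : ∀ e′ → decode e ≡ e′ → uses e paths ≤ capacity e′ * q
      bound start      eq = narrow eq start
      bound (source p) eq = narrow eq (source p)
      bound (cross p)  eq = narrow eq (cross p)
      bound (sink p)   eq = narrow eq (sink p)
      bound finish     _  = wide
      bound (bypass _) _  = wide
      bound (inject _) _  = wide
      bound (enter _)  _  = wide
      bound (leave _)  _  = wide
      bound (divert _) _  = wide

    feasible : Feasible network (uniform network r paths)
    feasible = uniform-feasible network q paths 0≤r q·r≡1
      (Allₚ.map⁺ (All.tabulate λ {i} _ → isSTPath (route i))) length-paths uses-≤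

  bypassing : Port → List E
  bypassing p = source p ∷ bypass p ∷ sink p ∷ []

  bypassing-route : ∀ p → Route t s (bypassing p)
  bypassing-route p = source p ∷ bypass p ∷ sink p ∷ []

  -- A feasible integral flow: one spine path and all bypasses

  module Integral where

    -- Leaves out `source` and `sink`, which separates the spine path from the bypassing paths.
    data OnSpine : E → Set where
      finish : OnSpine finish
      enter  : ∀ p → OnSpine (enter p)
      cross  : ∀ p → OnSpine (cross p)
      leave  : ∀ p → OnSpine (leave p)

    abstract
      -- Built backwards from the last spine vertex, always through gate `0F`.
      descent : ∀ j → ∃ λ es → Route t (spine j) es × All OnSpine es
      descent = >-weakInduction _ (_ , finish ∷ [] , finish ∷ []) λ j (_ , ρ , on) →
        let p = j , 0F in
        _ , enter p ∷ cross p ∷ leave p ∷ ρ , enter p ∷ cross p ∷ leave p ∷ on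

    Index : Set
    Index = Fin 1 ⊎ Port

    abstract
      Index↔ : Fin (1 + N * 2) ↔ Index
      Index↔ = (↔-id _ ⊎-↔ Finₚ.*↔×) ↔-∘ Finₚ.+↔⊎

    path : Index → List E
    path (inj₁ _) = start ∷ proj₁ (descent zero)
    path (inj₂ p) = bypassing p

    route : ∀ i → Route t s (path i)
    route (inj₁ _) = start ∷ proj₁ (proj₂ (descent zero))
    route (inj₂ p) = bypassing-route p

    -- Only the spine path can cross gates or use `start`; the source and the sink of a port belong
    -- to its own bypassing path.
    carriers : ∀ {e} → Bottleneck e → ∃ λ js → length js ≡ 1 × ∀ i → e ∈ path i → i ∈ js
    carriers start = inj₁ 0F ∷ [] , refl , λ where
      (inj₁ 0F) _                            → here refl
      (inj₂ p)  (there (there (there ())))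
    carriers (source p) = inj₂ p ∷ [] , refl , λ where
      (inj₁ 0F) (there e∈)                   → contradiction (All.lookup (proj₂ (proj₂ (descent zero))) e∈) λ ()
      (inj₂ _)  (here refl)                  → here refl
      (inj₂ _)  (there (there (there ())))
    carriers (cross p) = inj₁ 0F ∷ [] , refl , λ where
      (inj₁ 0F) _                            → here refl
      (inj₂ p)  (there (there (there ())))
    carriers (sink p) = inj₂ p ∷ [] , refl , λ where
      (inj₁ 0F) (there e∈)                   → contradiction (All.lookup (proj₂ (proj₂ (descent zero))) e∈) λ ()
      (inj₂ _)  (there (there (here refl)))  → here refl

    open Spread Index↔ 1 (sym (ℕₚ.*-identityʳ R)) (ℚₚ.nonNegative⁻¹ 1ℚ) refl path route carriers public

  -- The flow with rates 1/2

  module Fractional where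

    -- Two half units reach each spine vertex: by `start` at the first one, and at `suc j` from the
    -- two taps of stage `j`.
    arrive : Fin (suc N) → Fin 2 → List E
    arrive zero    b = start ∷ []
    arrive (suc j) b = source (j , b) ∷ inject (j , b) ∷ cross (j , b) ∷ leave (j , b) ∷ []

    arrive-route : ∀ j b → Route (spine j) s (arrive j b)
    arrive-route zero    b = start ∷ []
    arrive-route (suc j) b = source _ ∷ inject _ ∷ cross _ ∷ leave _ ∷ []

    -- The view tells the last spine vertex, which has no stage after it, from a vertex `inject₁ j`,
    -- which departs through stage `j`.
    depart : ∀ {j : Fin (suc N)} → View j → Fin 2 → List E
    depart ‵fromℕ             b = finish ∷ []
    depart (‵inj₁ {i = j} _)  b = enter (j , b) ∷ cross (j , b) ∷ divert (j , b) ∷ sink (j , b) ∷ []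

    depart-route : ∀ {j} (v : View j) b → Route t (spine j) (depart v b)
    depart-route ‵fromℕ    b = finish ∷ []
    depart-route (‵inj₁ _) b = enter _ ∷ cross _ ∷ divert _ ∷ sink _ ∷ []

    Index : Set
    Index = (Fin (suc N) × Fin 2) ⊎ Port

    abstract
      Index↔ : Fin (suc N * 2 + N * 2) ↔ Index
      Index↔ = (Finₚ.*↔× ⊎-↔ Finₚ.*↔×) ↔-∘ Finₚ.+↔⊎

    path : Index → List E
    path (inj₁ (j , b)) = arrive j b ++ depart (view j) b
    path (inj₂ p)       = bypassing p

    route : ∀ i → Route t s (path i)
    route (inj₁ (j , b)) = arrive-route j b ◅◅ depart-route (view j) b
    route (inj₂ p)       = bypassing-route p

    depart-delay : ∀ {j} (v : View j) b → sum (map delay (depart v b)) ≡ 0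
    depart-delay ‵fromℕ    b = refl
    depart-delay (‵inj₁ _) b = refl

    -- The single unit is paid on arrival, by `start` or by one `leave`; departing and bypassing are
    -- free.
    path-delay-≤ : ∀ i → sum (map delay (path i)) ≤ 1
    path-delay-≤ (inj₁ (zero , b))  rewrite depart-delay (view (zero {N})) b = ℕₚ.≤-refl
    path-delay-≤ (inj₁ (suc j , b)) rewrite depart-delay (view (suc j)) b    = ℕₚ.≤-refl
    path-delay-≤ (inj₂ p)           = z≤n

    length≡R*2 : suc N * 2 + N * 2 ≡ R * 2
    length≡R*2 = lemma N
      where
      lemma : ∀ N → suc N * 2 + N * 2 ≡ suc (N * 2) * 2
      lemma = solve-∀

    start∉depart : ∀ {j} (v : View j) {b} → ¬ start ∈ depart v b
    start∉depart ‵fromℕ    (there ())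
    start∉depart (‵inj₁ _) (there (there (there (there ()))))

    source∉depart : ∀ {j p} (v : View j) {b} → ¬ source p ∈ depart v b
    source∉depart ‵fromℕ    (there ())
    source∉depart (‵inj₁ _) (there (there (there (there ()))))

    cross∈depart : ∀ {j k c b} (v : View j) → cross (k , c) ∈ depart v b → (j , b) ≡ (inject₁ k , c)
    cross∈depart ‵fromℕ    (there ())
    cross∈depart (‵inj₁ _) (there (here refl)) = refl
    cross∈depart (‵inj₁ _) (there (there (there (there ()))))

    sink∈depart : ∀ {j k c b} (v : View j) → sink (k , c) ∈ depart v b → (j , b) ≡ (inject₁ k , c)
    sink∈depart ‵fromℕ    (there ())
    sink∈depart (‵inj₁ _) (there (there (there (here refl)))) = refl

    -- Two half units share each bottleneck. At a gate they are the departure from the spine vertex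
    -- before it and the arrival at the one after it; at a source an arrival and a bypass, at a sink
    -- a departure and a bypass.
    carriers : ∀ {e} → Bottleneck e → ∃ λ js → length js ≡ 2 × ∀ i → e ∈ path i → i ∈ js
    carriers start = inj₁ (zero , 0F) ∷ inj₁ (zero , 1F) ∷ [] , refl , λ where
      (inj₁ (zero , 0F)) _  → here refl
      (inj₁ (zero , 1F)) _  → there (here refl)
      (inj₁ (suc j , b)) (there (there (there (there e∈)))) → contradiction e∈ (start∉depart (view (suc j)))
      (inj₂ p) (there (there (there ())))
    carriers (source p@(j , b)) = inj₁ (suc j , b) ∷ inj₂ p ∷ [] , refl , λ where
      (inj₁ (zero , _)) (there e∈) → contradiction e∈ (source∉depart (view zero))
      (inj₁ (suc j , b)) (here refl) → here refl
      (inj₁ (suc j , b)) (there (there (there (there e∈)))) → contradiction e∈ (source∉depart (view (suc j)))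
      (inj₂ _) (here refl) → there (here refl)
      (inj₂ _) (there (there (there ())))
    carriers (cross (j , b)) = inj₁ (inject₁ j , b) ∷ inj₁ (suc j , b) ∷ [] , refl , λ where
      (inj₁ (zero , _)) (there e∈) → here (cong inj₁ (cross∈depart (view zero) e∈))
      (inj₁ (suc _ , _)) (there (there (here refl))) → there (here refl)
      (inj₁ (suc k , _)) (there (there (there (there e∈)))) → here (cong inj₁ (cross∈depart (view (suc k)) e∈))
      (inj₂ _) (there (there (there ())))
    carriers (sink p@(j , b)) = inj₁ (inject₁ j , b) ∷ inj₂ p ∷ [] , refl , λ where
      (inj₁ (zero , _)) (there e∈) → here (cong inj₁ (sink∈depart (view zero) e∈))
      (inj₁ (suc k , _)) (there (there (there (there e∈)))) → here (cong inj₁ (sink∈depart (view (suc k)) e∈))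
      (inj₂ _) (there (there (here refl))) → there (here refl)

    open Spread Index↔ 2 length≡R*2 (ℚₚ.nonNegative⁻¹ ½) refl path route carriers public

  -- The delay forced on integral flows

  module LowerBound
    (ps : List (List (Fin edges))) (isSTPaths : All (IsSTPath network) ps) (length≡R : length ps ≡ R)
    (uses≤ : ∀ e → uses e ps ≤ capacity (decode e)) where

    noReturn : ∀ e → ¬ tgt e ≡ s
    noReturn start      ()
    noReturn finish     ()
    noReturn (source _) ()
    noReturn (bypass _) ()
    noReturn (inject _) ()
    noReturn (enter _)  ()
    noReturn (cross _)  ()
    noReturn (leave _)  ()
    noReturn (divert _) ()
    noReturn (sink _)   ()

    routeOf : ∀ {p} → p ∈ ps → Route t s (map decode p)
    routeOf p∈ps = walk⇒route (proj₁ (All.lookup isSTPaths p∈ps))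

    rootEdge : Fin 1 ⊎ Port → E
    rootEdge (inj₁ _) = start
    rootEdge (inj₂ p) = source p

    src-rootEdge : ∀ i → src (rootEdge i) ≡ s
    src-rootEdge (inj₁ _) = refl
    src-rootEdge (inj₂ p) = refl

    code-uses-≤ : ∀ e → uses (code e) ps ≤ capacity e
    code-uses-≤ e = subst (λ e′ → uses (code e) ps ≤ capacity e′) (strictlyInverseˡ e) (uses≤ (code e))

    -- All edges out of `s`: a cut of `R` unit-capacity edges, to be met by exactly `R` unit paths.
    rootEdges : List (Fin edges)
    rootEdges = map (code ∘ rootEdge) (enumerate Integral.Index↔)

    rootEdges-cut : ∀ {p} → Route t s (map decode p) → Any (_∈ p) rootEdges
    rootEdges-cut {p} ρ = Anyₚ.map⁺ (first ρ refl id)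
      where
      first : ∀ {u es} → Route t u es → u ≡ s → es ⊆ map decode p →
              Any (λ i → code (rootEdge i) ∈ p) (enumerate Integral.Index↔)
      first (start ∷ _)    refl ⊆p = lose (∈-enumerate Integral.Index↔ (inj₁ 0F)) (code-∈ (⊆p (here refl)))
      first (source q ∷ _) refl ⊆p = lose (∈-enumerate Integral.Index↔ (inj₂ q)) (code-∈ (⊆p (here refl)))

    -- The cut out of `s` has no slack, so each of its edges is used, and it opens the path that
    -- uses it because no edge returns to `s`.
    rootEdge-saturated : ∀ i → ∃ λ p → p ∈ ps × ∃ λ es → map decode p ≡ rootEdge i ∷ es × Route t (tgt (rootEdge i)) es
    rootEdge-saturated i with find (cut-saturated rootEdges ps (All.tabulate (rootEdges-cut ∘ routeOf)) caps
                                     (ℕₚ.≤-reflexive length-rootEdges) (∈-map⁺ (code ∘ rootEdge) (∈-enumerate Integral.Index↔ i)))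
      where
      caps : ∀ {e} → e ∈ rootEdges → uses e ps ≤ 1
      caps e∈ with ∈-map⁻ (code ∘ rootEdge) e∈
      ... | inj₁ _ , _ , refl = code-uses-≤ start
      ... | inj₂ q , _ , refl = code-uses-≤ (source q)
      length-rootEdges : length rootEdges ≡ length ps
      length-rootEdges = trans (Listₚ.length-map _ (enumerate Integral.Index↔))
                           (trans (length-enumerate Integral.Index↔) (sym length≡R))
    ... | p , p∈ps , e∈p = p , p∈ps ,
      root-edge-first noReturn (routeOf p∈ps) (src-rootEdge i)
        (subst (_∈ map decode p) (strictlyInverseˡ (rootEdge i)) (∈-map⁺ decode e∈p))

    drain-route : ∀ {u es p} → Route t u es → u ≡ drain p → sink p ∈ es
    drain-route (sink p ∷ _) refl = here refl

    gateIn-route : ∀ {u es p} → Route t u es → u ≡ gateIn p → cross p ∈ es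
    gateIn-route (cross p ∷ _) refl = here refl

    -- Of the two ways out of a tap, `bypass` forces the sink of the port and `inject` forces its
    -- gate.
    tap-route : ∀ {u es p} → Route t u es → u ≡ tap p → sink p ∈ es ⊎ cross p ∈ es
    tap-route (bypass p ∷ ρ) refl = inj₁ (there (drain-route ρ refl))
    tap-route (inject p ∷ ρ) refl = inj₂ (there (gateIn-route ρ refl))

    module _ {p : List (Fin edges)} {es₀ : List E} (p∈ps : p ∈ ps) (p≡ : map decode p ≡ start ∷ es₀) where

      -- The unit path from the tap of `x` occupies either the gate or the sink of `x`. Both have
      -- capacity 1, so the path `p` cannot have both of them.
      cross-sink-exclusive : ∀ {x} → cross x ∈ map decode p → ¬ sink x ∈ map decode p
      cross-sink-exclusive {x} cross∈p sink∈p
        with q , q∈ps , fs , q≡ , ρ ← rootEdge-saturated (inj₂ x) =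
        [ clash (sink x) refl sink∈p , clash (cross x) refl cross∈p ]′ (tap-route ρ refl)
        where
        p≢q : ¬ p ≡ q
        -- The first edges differ: `start` for `p`, `source x` for `q`.
        p≢q refl with () ← trans (sym p≡) q≡
        clash : ∀ e → capacity e ≡ 1 → e ∈ map decode p → ¬ e ∈ fs
        clash e c≡1 e∈p e∈fs = contradiction
          (ℕₚ.≤-trans (shared⇒2≤uses p∈ps q∈ps p≢q (code-∈ e∈p) (code-∈ (subst (e ∈_) (sym q≡) (there e∈fs))))
             (ℕₚ.≤-trans (code-uses-≤ e) (ℕₚ.≤-reflexive c≡1)))
          λ where (s≤s ())

      -- Mutual induction along the route, with `toℕ j` stages already behind. Once gate `j` is
      -- crossed, `divert` would lead to the sink of the same port, which `cross-sink-exclusive`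
      -- forbids; the route must take `leave` and pay 1. Hence `gateOut-delay` remembers the crossed
      -- gate.
      spine-delay : ∀ {u es j} → Route t u es → u ≡ spine j → es ⊆ map decode p → N ≤ toℕ j + sum (map delay es)
      gateIn-delay : ∀ {u es j b} → Route t u es → u ≡ gateIn (j , b) → es ⊆ map decode p → N ≤ toℕ j + sum (map delay es)
      gateOut-delay : ∀ {u es j b} → Route t u es → u ≡ gateOut (j , b) → cross (j , b) ∈ map decode p → es ⊆ map decode p →
                      N ≤ toℕ j + sum (map delay es)

      spine-delay (finish ∷ _) refl _ rewrite Finₚ.toℕ-fromℕ N = ℕₚ.m≤m+n N _
      spine-delay (enter (j , _) ∷ ρ) refl ⊆p rewrite Finₚ.toℕ-inject₁ j = gateIn-delay ρ refl (⊆p ∘ there)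

      gateIn-delay (cross _ ∷ ρ) refl ⊆p = gateOut-delay ρ refl (⊆p (here refl)) (⊆p ∘ there)

      gateOut-delay {j = j} (leave _ ∷ ρ) refl _ ⊆p =
        subst (N ≤_) (sym (ℕₚ.+-suc (toℕ j) _)) (spine-delay ρ refl (⊆p ∘ there))
      gateOut-delay (divert _ ∷ ρ) refl cross∈p ⊆p =
        contradiction (⊆p (there (drain-route ρ refl))) (cross-sink-exclusive cross∈p)

    -- The witness is the path that saturates `start`: it begins on the spine at stage 0.
    slow-path : ∃ λ p → p ∈ ps × N ≤ pathDelay network p
    slow-path with p , p∈ps , es , p≡ , ρ ← rootEdge-saturated (inj₁ 0F) = p , p∈ps , (begin
      N                              ≤⟨ spine-delay p∈ps p≡ ρ refl (subst (_ ∈_) (sym p≡) ∘ there) ⟩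
      sum (map delay es)             ≤⟨ ℕₚ.n≤1+n _ ⟩
      sum (map delay (start ∷ es))   ≡⟨ cong (sum ∘ map delay) p≡ ⟨
      sum (map delay (map decode p)) ≡⟨ pathDelay-decode p ⟨
      pathDelay network p            ∎)
      where open ℕₚ.≤-Reasoning hiding (start)

  -- Comparison of the integral and the fractional maximum delay

  integral-maxDelay-≥ : ∀ g → Feasible network g → IntegralFlow network g → N ≤ maxDelay network g
  integral-maxDelay-≥ g (sts , total≡R , load≤) int =
    let p , p∈ps , N≤p = slow-path in ℕₚ.≤-trans N≤p (All.lookup delay≤ p∈ps)
    where
    open UnitPaths (unitPaths network g (All.map proj₁ sts) int) renaming (isSTPath to isSTPaths)
    open LowerBound paths isSTPaths (/1-injective (trans (sym total≡) total≡R))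
      (λ e → /1-cancel-≤ (subst (ℚ._≤ _) (load≡ e) (load≤ e)))

  fractional-flow : Flow network
  fractional-flow = uniform network ½ Fractional.paths

  fractional-maxDelay-≤ : maxDelay network fractional-flow ≤ 1
  fractional-maxDelay-≤ = maxDelay-uniform-≤ network ½ {paths}
    (Allₚ.map⁺ {f = encode ∘ path} (All.tabulate {xs = enumerate Index↔} λ {i} _ →
      ℕₚ.≤-trans (ℕₚ.≤-reflexive (pathDelay-encode (path i))) (path-delay-≤ i)))
    where open Fractional

  fractional-maxDelay-> : 0 < maxDelay network fractional-flow
  fractional-maxDelay-> = ℕₚ.≤-trans
    (ℕₚ.≤-trans (s≤s z≤n) (ℕₚ.≤-reflexive (sym (pathDelay-encode (path i)))))
    (pathDelay≤maxDelay network (∈-map⁺ (_, ½) (∈-map⁺ (encode ∘ path) (∈-enumerate Index↔ i))) (ℚₚ.positive⁻¹ ½))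
    where
    open Fractional
    i : Index
    i = inj₁ (zero , 0F)

-- A feasible `f` bounds the real optimum from above, and the last component covers every integral
-- flow, optimal ones included; together they bound the gap below by `M`. The witness has `M`
-- stages: `f` has delay at most 1, integral flows at least `M`.
theorem5 : (M : ℕ) → 0 < M →
    Σ Instance λ I →
    (Σ (Flow I) λ g → Feasible I g × IntegralFlow I g)
    × Σ (Flow I) λ f → Feasible I f × 0 < maxDelay I f
    × ((g : Flow I) → Feasible I g → IntegralFlow I g →
    M * maxDelay I f ≤ maxDelay I g)
theorem5 M _ =
    network
  , (uniform network 1ℚ Integral.paths , Integral.feasible , uniform-1-integral network Integral.paths)
  , fractional-flow , Fractional.feasible , fractional-maxDelay->
  , λ g feasible integral → begin
      M * maxDelay network fractional-flow ≤⟨ ℕₚ.*-monoʳ-≤ M fractional-maxDelay-≤ ⟩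
      M * 1                                ≡⟨ ℕₚ.*-identityʳ M ⟩
      M                                    ≤⟨ integral-maxDelay-≥ g feasible integral ⟩
      maxDelay network g                   ∎
  where
  open Stages M
  open ℕₚ.≤-Reasoning
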